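{- Let $n\ge1$. If $\phi$ is an existential first order sentence over the vocabulary $\{<\}$ expressing the property that the length of a linear order is at least $n$, then the size of $\phi$ is at least $2n-1$.
   Context: First order logic has equality; models have nonempty universe. An existential formula is one built from atomic formulas and negations of atomic formulas using only $\vee$, $\wedge$ and $\exists x_j$. The size $\mathrm{w}$ of a formula is defined by $\mathrm{w}(\phi)=1$ for atomic $\phi$, $\mathrm{w}(\neg\phi)=\mathrm{w}(\phi)$, $\mathrm{w}(\phi\vee\psi)=\mathrm{w}(\phi\wedge\psi)=\mathrm{w}(\phi)+\mathrm{w}(\psi)$, $\mathrm{w}(\exists x_j\phi)=\mathrm{w}(\phi)+1$. Linear orders are strict linear orders viewed as $\{<\}$-models; the length of a linear order is its number of elements. The sentence $\phi$ expresses that the length is at least $n$ if for every linear order, $\phi$ is true in it iff it has at least $n$ elements. -}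

module Defs where

open import Data.Fin.Base using (Fin)
open import Data.Nat.Base using (ℕ; suc; _+_)
open import Data.Product.Base using (_×_; ∃-syntax)
open import Data.Sum.Base using (_⊎_)
open import Data.Vec.Base using (Vec; []; _∷_; lookup)
open import Function.Bundles using (_⇔_; _↣_)
open import Level using (0ℓ)
open import Relation.Binary.Core using (Rel)
open import Relation.Binary.PropositionalEquality.Core using (_≡_)
open import Relation.Binary.Structures using (IsStrictTotalOrder)
open import Relation.Nullary.Negation.Core using (¬_)

infix  8 _≐_ _≺_
infix  7 ¬′_
infixr 6 _∧′_
infixr 5 _∨′_

private
  variable
    k : ℕ

-- Formulas over {<} are well scoped, with de Bruijn indices for variables:
-- the free variables of a formula in Formula k are among the k indices in Fin k.
-- A universal quantifier is available as ¬ ∃ ¬.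

data Atom (k : ℕ) : Set where
  _≐_ : Fin k → Fin k → Atom k
  _≺_ : Fin k → Fin k → Atom k

data Formula (k : ℕ) : Set where
  atom : Atom k → Formula k
  ¬′_  : Formula k → Formula k
  _∨′_ : Formula k → Formula k → Formula k
  _∧′_ : Formula k → Formula k → Formula k
  ∃′   : Formula (suc k) → Formula k

Sentence : Set
Sentence = Formula 0

data Existential {k : ℕ} : Formula k → Set where
  atom  : (a : Atom k) → Existential (atom a)
  ¬atom : (a : Atom k) → Existential (¬′ atom a)
  _∨′_  : {φ ψ : Formula k} → Existential φ → Existential ψ → Existential (φ ∨′ ψ)
  _∧′_  : {φ ψ : Formula k} → Existential φ → Existential ψ → Existential (φ ∧′ ψ)
  ∃′    : {φ : Formula (suc k)} → Existential φ → Existential (∃′ φ)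

w : Formula k → ℕ
w (atom _) = 1
w (¬′ φ)   = w φ
w (φ ∨′ ψ) = w φ + w ψ
w (φ ∧′ ψ) = w φ + w ψ
w (∃′ φ)   = w φ + 1

record LinearOrder : Set₁ where
  field
    Carrier            : Set
    _<_                : Rel Carrier 0ℓ
    isStrictTotalOrder : IsStrictTotalOrder _≡_ _<_
    -- Universes of models are nonempty.
    point              : Carrier

module Semantics (L : LinearOrder) where
  open LinearOrder L

  ⟦_⟧ᵃ : Atom k → Vec Carrier k → Set
  ⟦ i ≐ j ⟧ᵃ ρ = lookup ρ i ≡ lookup ρ j
  ⟦ i ≺ j ⟧ᵃ ρ = lookup ρ i < lookup ρ j

  ⟦_⟧ : Formula k → Vec Carrier k → Set
  ⟦ atom a ⟧ ρ = ⟦ a ⟧ᵃ ρ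
  ⟦ ¬′ φ ⟧   ρ = ¬ ⟦ φ ⟧ ρ
  ⟦ φ ∨′ ψ ⟧ ρ = ⟦ φ ⟧ ρ ⊎ ⟦ ψ ⟧ ρ
  ⟦ φ ∧′ ψ ⟧ ρ = ⟦ φ ⟧ ρ × ⟦ ψ ⟧ ρ
  ⟦ ∃′ φ ⟧   ρ = ∃[ a ] ⟦ φ ⟧ (a ∷ ρ)

infix 4 _⊨_

_⊨_ : LinearOrder → Sentence → Set
L ⊨ φ = Semantics.⟦_⟧ L φ []

LengthAtLeast : ℕ → LinearOrder → Set
LengthAtLeast n L = Fin n ↣ LinearOrder.Carrier L

ExpressesLengthAtLeast : ℕ → Sentence → Set₁
ExpressesLengthAtLeast n φ = (L : LinearOrder) → L ⊨ φ ⇔ LengthAtLeast n L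

{-# OPTIONS --safe #-}

-- Make φ true in the order with n elements and put the following marks on the
-- number line: 2a whenever a is chosen as a witness for a quantifier, and a + b
-- whenever a literal about the elements a and b is used.  At most w φ marks are
-- placed.  Identifying i with i + 1 is a monotone map onto the order with n − 1
-- elements, where φ fails.  So some literal used must be about i and i + 1, which
-- puts marks at 2i, 2i + 1 and 2i + 2.  Hence all of 0, …, 2n − 2 are marked.

module Submission where

open import Data.Fin.Base as Fin using (Fin; zero; suc; toℕ; inject₁; pinch; combine; remQuot)
open import Data.Fin.Properties as Fin using (injective⇒≤; pinch-mono-≤; combine-remQuot; toℕ-combine; toℕ-injective; toℕ-inject₁)
open import Data.List.Base using (List; []; _∷_; [_]; _++_; length)
open import Data.List.Membership.DecPropositional using (_∈?_)
open import Data.List.Membership.Propositional using (_∈_)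
open import Data.List.Membership.Setoid.Properties using (index-injective)
open import Data.List.Properties using (length-++)
open import Data.List.Relation.Binary.Subset.Propositional using (_⊆_)
open import Data.List.Relation.Binary.Subset.Propositional.Properties using (⊆-refl; ⊆-trans; xs⊆x∷xs; xs⊆xs++ys; xs⊆ys++xs)
open import Data.List.Relation.Unary.Any using (here)
open import Data.Nat.Base using (ℕ; zero; suc; _+_; _≤_; _*_; _∸_; s≤s; z≤n)
open import Data.Nat.Properties using (_≟_; ≤-refl; ≤-trans; <-irrefl; <⇒≤; <⇒≱; ≰⇒>; m≤m+n; m≤n+m; +-comm; +-identityʳ; +-mono-≤; +-suc; *-comm; module ≤-Reasoning)
open import Data.Product.Base using (_×_; _,_; proj₁; proj₂)
open import Data.Sum.Base using (_⊎_; inj₁; inj₂)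
open import Data.Vec.Base as Vec using (Vec; _∷_; []; lookup)
open import Data.Vec.Properties using (lookup-map)
open import Function.Base using (_∘_)
open import Function.Bundles using (Equivalence; Injection; mk↣)
open import Relation.Binary.PropositionalEquality using (_≡_; refl; sym; cong; subst; setoid)
open import Relation.Nullary.Decidable using (_×-dec_; decidable-stable)
open import Relation.Nullary.Negation.Core using (¬_; contradiction)
open import Defs

-- The index is shifted by one, so that the universe is never empty: `finOrder n` has `n + 1`
-- elements.
finOrder : ℕ → LinearOrder
finOrder n = record
  { Carrier            = Fin (suc n)
  ; _<_                = Fin._<_
  ; isStrictTotalOrder = Fin.<-isStrictTotalOrder
  ; point              = zero
  }

finOrder-longEnough : ∀ n → LengthAtLeast (suc n) (finOrder n)
finOrder-longEnough n = mk↣ {to = λ i → i} λ eq → eq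

finOrder-tooShort : ∀ n → ¬ LengthAtLeast (suc (suc n)) (finOrder n)
finOrder-tooShort n inj = <-irrefl refl (injective⇒≤ (Injection.injective inj))

pinch-collision : ∀ {n} (i : Fin n) j k → pinch i j ≡ pinch i k →
                  j ≡ k ⊎ (j ≡ inject₁ i × k ≡ suc i) ⊎ (j ≡ suc i × k ≡ inject₁ i)
pinch-collision zero    zero    zero    eq = inj₁ refl
pinch-collision zero    zero    (suc k) eq = inj₂ (inj₁ (refl , cong suc (sym eq)))
pinch-collision zero    (suc j) zero    eq = inj₂ (inj₂ (cong suc eq , refl))
pinch-collision zero    (suc j) (suc k) eq = inj₁ (cong suc eq)
pinch-collision (suc i) zero    zero    eq = inj₁ refl
pinch-collision (suc i) (suc j) (suc k) eq with pinch-collision i j k (Fin.suc-injective eq)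
... | inj₁ refl                 = inj₁ refl
... | inj₂ (inj₁ (refl , refl)) = inj₂ (inj₁ (refl , refl))
... | inj₂ (inj₂ (refl , refl)) = inj₂ (inj₂ (refl , refl))

-- Sending `k` to a position of `xs` where it occurs is injective, since a position determines its
-- entry.
all∈⇒≤length : ∀ {N} (xs : List ℕ) → (∀ (k : Fin N) → toℕ k ∈ xs) → N ≤ length xs
all∈⇒≤length xs mem =
  injective⇒≤ λ {j} {k} eq → toℕ-injective (index-injective (setoid ℕ) (mem j) (mem k) eq)

w-positive : ∀ {k} (φ : Formula k) → 1 ≤ w φ
w-positive (atom _) = s≤s z≤n
w-positive (¬′ φ)   = w-positive φ
w-positive (φ ∨′ ψ) = ≤-trans (w-positive φ) (m≤m+n _ _)
w-positive (φ ∧′ ψ) = ≤-trans (w-positive φ) (m≤m+n _ _)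
w-positive (∃′ φ)   = m≤n+m 1 (w φ)

mark : ∀ {n} → Fin n → Fin n → ℕ
mark a b = toℕ a + toℕ b

-- As `combine i r` stands for `2i + r`, the positive marks are numbered by a gap `i` and a bit `r`:
-- bit 0 gives the odd mark `2i + 1`, bit 1 the even mark `2i + 2`.
mark-odd : ∀ {n} (i : Fin n) → mark (inject₁ i) (suc i) ≡ suc (toℕ (combine i (zero {1})))
mark-odd i
  rewrite toℕ-inject₁ i | toℕ-combine i (zero {1}) | +-identityʳ (toℕ i) | +-identityʳ (toℕ i + toℕ i)
  = +-suc (toℕ i) (toℕ i)

mark-even : ∀ {n} (i : Fin n) → mark (suc i) (suc i) ≡ suc (toℕ (combine i (suc (zero {0}))))
mark-even i
  rewrite toℕ-combine i (suc (zero {0})) | +-identityʳ (toℕ i) | +-comm (toℕ i + toℕ i) 1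
  = cong suc (+-suc (toℕ i) (toℕ i))

module _ {n : ℕ} where
  open Semantics (finOrder n)

  atomMark : ∀ {k} → Atom k → Vec (Fin (suc n)) k → ℕ
  atomMark (i ≐ j) ρ = mark (lookup ρ i) (lookup ρ j)
  atomMark (i ≺ j) ρ = mark (lookup ρ i) (lookup ρ j)

  marks : ∀ {k} {φ : Formula k} → Existential φ → (ρ : Vec (Fin (suc n)) k) → ⟦ φ ⟧ ρ → List ℕ
  marks (atom a)  ρ _        = [ atomMark a ρ ]
  marks (¬atom a) ρ _        = [ atomMark a ρ ]
  marks (e ∨′ f)  ρ (inj₁ p) = marks e ρ p
  marks (e ∨′ f)  ρ (inj₂ p) = marks f ρ p
  marks (e ∧′ f)  ρ (p , q)  = marks e ρ p ++ marks f ρ q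
  marks (∃′ e)    ρ (a , p)  = mark a a ∷ marks e (a ∷ ρ) p

  length-marks : ∀ {k} {φ : Formula k} (e : Existential φ) ρ (p : ⟦ φ ⟧ ρ) →
                 length (marks e ρ p) ≤ w φ
  length-marks (atom _)  ρ _        = ≤-refl
  length-marks (¬atom _) ρ _        = ≤-refl
  length-marks (e ∨′ f)  ρ (inj₁ p) = ≤-trans (length-marks e ρ p) (m≤m+n _ _)
  length-marks (e ∨′ f)  ρ (inj₂ p) = ≤-trans (length-marks f ρ p) (m≤n+m _ _)
  length-marks (e ∧′ f)  ρ (p , q)  = begin
    length (marks e ρ p ++ marks f ρ q)          ≡⟨ length-++ (marks e ρ p) ⟩
    length (marks e ρ p) + length (marks f ρ q)  ≤⟨ +-mono-≤ (length-marks e ρ p) (length-marks f ρ q) ⟩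
    _                                            ∎
    where open ≤-Reasoning
  length-marks {φ = ∃′ φ} (∃′ e) ρ (a , p) = begin
    suc (length (marks e (a ∷ ρ) p))  ≤⟨ s≤s (length-marks e (a ∷ ρ) p) ⟩
    suc (w φ)                         ≡⟨ +-comm 1 (w φ) ⟩
    w φ + 1                           ∎
    where open ≤-Reasoning

module _ {n m : ℕ} (ms : List ℕ) (f : Fin (suc n) → Fin (suc m))
         (f-mono : ∀ {a b} → a Fin.≤ b → f a Fin.≤ f b)
         (f-inj : ∀ {a b} → mark a a ∈ ms → mark b b ∈ ms → mark a b ∈ ms → f a ≡ f b → a ≡ b)
  where
  private
    module N = Semantics (finOrder n)
    module M = Semantics (finOrder m)

  -- Invariant of the induction in `preserve`: each entry of the environment was chosen as a
  -- witness, which placed its mark.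
  Marked : ∀ {k} → Vec (Fin (suc n)) k → Set
  Marked ρ = ∀ i → mark (lookup ρ i) (lookup ρ i) ∈ ms

  preserve-atom : ∀ {k} (a : Atom k) {ρ} → Marked ρ → atomMark a ρ ∈ ms →
                  N.⟦ a ⟧ᵃ ρ → M.⟦ a ⟧ᵃ (Vec.map f ρ)
  preserve-atom (i ≐ j) {ρ} _ _ p
    rewrite lookup-map i f ρ | lookup-map j f ρ = cong f p
  preserve-atom (i ≺ j) {ρ} ρ∈ a∈ p
    rewrite lookup-map i f ρ | lookup-map j f ρ =
    Fin.≤∧≢⇒< (f-mono (<⇒≤ p)) (Fin.<⇒≢ p ∘ f-inj (ρ∈ i) (ρ∈ j) a∈)

  -- Needed for negated atoms. The roles are exchanged with `preserve-atom`: here equality uses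
  -- `f-inj`, while the order follows from monotonicity and totality.
  reflect-atom : ∀ {k} (a : Atom k) {ρ} → Marked ρ → atomMark a ρ ∈ ms →
                 M.⟦ a ⟧ᵃ (Vec.map f ρ) → N.⟦ a ⟧ᵃ ρ
  reflect-atom (i ≐ j) {ρ} ρ∈ a∈ q
    rewrite lookup-map i f ρ | lookup-map j f ρ = f-inj (ρ∈ i) (ρ∈ j) a∈ q
  reflect-atom (i ≺ j) {ρ} _ _ q
    rewrite lookup-map i f ρ | lookup-map j f ρ = ≰⇒> λ j≤i → <⇒≱ q (f-mono j≤i)

  -- The proof `p` is replayed with each witness `a` replaced by `f a`. Only the literals that `p`
  -- actually uses have to survive, so injectivity on marked pairs is enough.
  preserve : ∀ {k} {φ : Formula k} (e : Existential φ) {ρ} (p : N.⟦ φ ⟧ ρ) →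
             Marked ρ → marks e ρ p ⊆ ms → M.⟦ φ ⟧ (Vec.map f ρ)
  preserve (atom a)  p        ρ∈ sub = preserve-atom a ρ∈ (sub (here refl)) p
  preserve (¬atom a) p        ρ∈ sub = p ∘ reflect-atom a ρ∈ (sub (here refl))
  preserve (e ∨′ g)  (inj₁ p) ρ∈ sub = inj₁ (preserve e p ρ∈ sub)
  preserve (e ∨′ g)  (inj₂ p) ρ∈ sub = inj₂ (preserve g p ρ∈ sub)
  preserve (e ∧′ g)  (p , q)  ρ∈ sub =
    preserve e p ρ∈ (⊆-trans (xs⊆xs++ys _ _) sub) ,
    preserve g q ρ∈ (⊆-trans (xs⊆ys++xs _ _) sub)
  preserve (∃′ e)    (a , p)  ρ∈ sub =
    f a , preserve e p (λ { zero → sub (here refl) ; (suc i) → ρ∈ i })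
                       (⊆-trans (xs⊆x∷xs _ _) sub)

module _ {m : ℕ} {φ : Sentence} (e : Existential φ)
         (long : finOrder (suc m) ⊨ φ) (short : ¬ (finOrder m ⊨ φ)) where

  private
    ms : List ℕ
    ms = marks e [] long

  MarkedAround : Fin (suc m) → Set
  MarkedAround i =
    mark (inject₁ i) (inject₁ i) ∈ ms × mark (inject₁ i) (suc i) ∈ ms × mark (suc i) (suc i) ∈ ms

  markedAround : ∀ i → MarkedAround i
  markedAround i =
    -- Membership in a list of numbers is decidable, so arguing by contradiction is constructive. If
    -- one of the three marks is missing, `pinch i` identifies no marked pair and carries `φ` to the
    -- shorter order.
    decidable-stable (_∈?_ _≟_ _ _ ×-dec _∈?_ _≟_ _ _ ×-dec _∈?_ _≟_ _ _) λ ¬around →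
      short (preserve ms (pinch i) (pinch-mono-≤ i) (inj ¬around) e long (λ ()) ⊆-refl)
    where
    inj : ¬ MarkedAround i → ∀ {a b} → mark a a ∈ ms → mark b b ∈ ms → mark a b ∈ ms →
          pinch i a ≡ pinch i b → a ≡ b
    inj ¬around {a} {b} aa bb ab eq with pinch-collision i a b eq
    ... | inj₁ a≡b                  = a≡b
    ... | inj₂ (inj₁ (refl , refl)) = contradiction (aa , ab , bb) ¬around
    -- The literal may mention the two elements in reverse order; its mark, being a sum, is the
    -- same.
    ... | inj₂ (inj₂ (refl , refl)) =
      contradiction (bb , subst (_∈ ms) (+-comm (toℕ a) (toℕ b)) ab , aa) ¬around

  allMarked : ∀ (k : Fin (suc (suc m * 2))) → toℕ k ∈ ms
  -- Mark 0 is the only one that is not the middle or upper mark of a gap; it is the lower mark of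
  -- the first gap.
  allMarked zero = proj₁ (markedAround zero)
  allMarked (suc k) =
    subst (λ l → suc (toℕ l) ∈ ms) (combine-remQuot {suc m} 2 k)
      (marked (proj₁ (remQuot {suc m} 2 k)) (proj₂ (remQuot {suc m} 2 k)))
    where
    marked : ∀ (i : Fin (suc m)) (r : Fin 2) → suc (toℕ (combine i r)) ∈ ms
    marked i zero       = subst (_∈ ms) (mark-odd i) (proj₁ (proj₂ (markedAround i)))
    marked i (suc zero) = subst (_∈ ms) (mark-even i) (proj₂ (proj₂ (markedAround i)))

  size-bound : suc (suc m * 2) ≤ w φ
  size-bound = ≤-trans (all∈⇒≤length ms allMarked) (length-marks e [] long)

corollary21 : (n : ℕ) → 1 ≤ n → (φ : Sentence) → Existential φ → ExpressesLengthAtLeast n φ → 2 * n ∸ 1 ≤ w φ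
-- For `n = 1` there is no shorter nonempty order to collapse onto, but the bound is just 1.
corollary21 (suc zero)    _ φ _ _  = w-positive φ
corollary21 (suc (suc m)) _ φ e ex =
  -- With the factors swapped, `suc (suc m) * 2 ∸ 1` computes to `suc (suc m * 2)`.
  subst (λ x → x ∸ 1 ≤ w φ) (*-comm (suc (suc m)) 2)
    (size-bound e
      (Equivalence.from (ex (finOrder (suc m))) (finOrder-longEnough (suc m)))
      (finOrder-tooShort m ∘ Equivalence.to (ex (finOrder m))))
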